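{- Let $T_0$ be a consistent theory in a signature $\Sigma(T_0)$, let $C$ be a set of new constant symbols, and let $T\supseteq T_0$ be a complete theory in the signature $\Sigma(T_0)\cup C$ such that whenever $\exists y\,\varphi(y)\in T$ there is $c\in C$ with $\varphi(c)\in T$. Let $\mathcal{M}_0\models T_0$ and let $\mathcal{M}$ be an expansion of $\mathcal{M}_0$ to the signature $\Sigma(T_0)\cup C$ in which every element is named by infinitely many constants of $C$. Then the following conditions are equivalent: (1) $\mathcal{M}$ satisfies the preserving condition (relative to $T$); (2) the restriction $\mathcal{M}\upharpoonright\Sigma(T_0)$ satisfies the preserving condition (relative to $T$); (3) $\mathcal{M}$ is a canonical model of the completion $T$ of $T_0$.
   Context: For $c\in C$ let $[c]$ denote the element of $\mathcal{M}$ named by $c$; $M$ is the common universe of $\mathcal{M}$ and $\mathcal{M}\upharpoonright\Sigma(T_0)$. Preserving condition (relative to $T$), for $\mathcal{N}=\mathcal{M}$ or $\mathcal{N}=\mathcal{M}\upharpoonright\Sigma(T_0)$: for every $\Sigma(T_0)$-formula $\varphi(x_1,\ldots,x_n,x)$ and all $c_1,\ldots,c_n\in C$, if $\exists x\,\varphi(c_1,\ldots,c_n,x)\in T$ then $\varphi(x_1,\ldots,x_n,x)$ is $\exists$-partially $(\{[c_1]\},\ldots,\{[c_n]\},M)$-preserving in $\mathcal{N}$, i.e. $\varphi([c_1],\ldots,[c_n],\mathcal{N})\cap M\neq\emptyset$, where $\varphi(a_1,\ldots,a_n,\mathcal{N})=\{b\in M\mid\mathcal{N}\models\varphi(a_1,\ldots,a_n,b)\}$.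 Canonical model of $T$: the structure whose elements are the equivalence classes $\{c'\in C\mid (c'\approx c)\in T\}$, $c\in C$ (all of them infinite), where each constant symbol is interpreted by its own class, $f([c_1],\ldots,[c_n])=[c]$ iff $(f(c_1,\ldots,c_n)\approx c)\in T$ for each functional symbol $f\in\Sigma(T_0)$, and $R([c_1],\ldots,[c_n])$ holds iff $R(c_1,\ldots,c_n)\in T$ for each relational symbol $R\in\Sigma(T_0)$. The structure $\mathcal{M}$ is said to be a canonical model of $T$ if it is this structure after identifying the element named by $c$ with the class of $c$. -}

module Defs where

open import Data.Empty.Polymorphic using (⊥)
open import Data.Fin.Base using (Fin; zero; suc)
open import Data.List.Base as List using (List)
open import Data.List.Membership.Propositional using (_∉_) renaming (_∈_ to _∈ˡ_)
open import Data.List.Relation.Binary.Subset.Propositional using () renaming (_⊆_ to _⊆ˡ_)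
open import Data.List.Relation.Unary.All as All using (All)
open import Data.List.Relation.Unary.Any using (here; there)
open import Data.Nat.Base using (ℕ; zero; suc)
open import Data.Product.Base using (_×_; _,_; proj₁; proj₂; ∃)
open import Data.Sum.Base using (_⊎_; inj₁; inj₂)
open import Data.Vec.Base as Vec using (Vec; []; _∷_; lookup)
open import Data.Vec.Relation.Binary.Pointwise.Inductive as Pointwise using (Pointwise; []; _∷_)
open import Function.Base using (_∘_)
open import Function.Bundles using (_⇔_; mk⇔; module Equivalence)
open import Function.Definitions using (Congruent; Bijective)
open import Level using (Level)
import Relation.Binary.Core as Binary
open import Relation.Binary.Structures using (IsEquivalence)
open import Relation.Binary.PropositionalEquality using (_≡_; refl; sym; cong; subst)
open import Relation.Nullary.Negation using (¬_; contradiction)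
open import Relation.Unary using (Pred; _∈_; _≬_; U)

private
  variable
    ℓ : Level
    k m n : ℕ

record Signature (ℓ : Level) : Set (Level.suc ℓ) where
  field
    Fun : ℕ → Set ℓ
    Rel : ℕ → Set ℓ

open Signature public

-- Nullary function symbols are the constant symbols.

data Fun⁺ (L : Signature ℓ) (C : Set ℓ) : ℕ → Set ℓ where
  old : Fun L k → Fun⁺ L C k
  con : C → Fun⁺ L C 0

infixl 6 _∪ᶜ_

_∪ᶜ_ : Signature ℓ → Set ℓ → Signature ℓ
L ∪ᶜ C = record { Fun = Fun⁺ L C ; Rel = Rel L }

data Term (L : Signature ℓ) (n : ℕ) : Set ℓ where
  var : Fin n → Term L n
  fun : Fun L k → Vec (Term L n) k → Term L n

-- De Bruijn indices: `∀'` and `∃'` bind the variable `zero`.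

infix  8 _≈'_
infixr 7 _∧'_
infixr 6 _∨'_
infixr 5 _⇒'_
infix  9 ¬'_

data Formula (L : Signature ℓ) (n : ℕ) : Set ℓ where
  ⊥'   : Formula L n
  _≈'_ : Term L n → Term L n → Formula L n
  rel  : Rel L k → Vec (Term L n) k → Formula L n
  _∧'_ : Formula L n → Formula L n → Formula L n
  _∨'_ : Formula L n → Formula L n → Formula L n
  _⇒'_ : Formula L n → Formula L n → Formula L n
  ∀'   : Formula L (suc n) → Formula L n
  ∃'   : Formula L (suc n) → Formula L n

¬'_ : {L : Signature ℓ} → Formula L n → Formula L n
¬' φ = φ ⇒' ⊥'

Sentence : Signature ℓ → Set ℓ
Sentence L = Formula L 0

module _ {L : Signature ℓ} where

  subᵗ : (Fin n → Term L m) → Term L n → Term L m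
  subᵗˢ : (Fin n → Term L m) → Vec (Term L n) k → Vec (Term L m) k

  subᵗ σ (var i)    = σ i
  subᵗ σ (fun f ts) = fun f (subᵗˢ σ ts)

  subᵗˢ σ []       = []
  subᵗˢ σ (t ∷ ts) = subᵗ σ t ∷ subᵗˢ σ ts

  lift : (Fin n → Term L m) → Fin (suc n) → Term L (suc m)
  lift σ zero    = var zero
  lift σ (suc i) = subᵗ (var ∘ suc) (σ i)

  sub : (Fin n → Term L m) → Formula L n → Formula L m
  sub σ ⊥'         = ⊥'
  sub σ (s ≈' t)   = subᵗ σ s ≈' subᵗ σ t
  sub σ (rel R ts) = rel R (subᵗˢ σ ts)
  sub σ (φ ∧' ψ)   = sub σ φ ∧' sub σ ψ
  sub σ (φ ∨' ψ)   = sub σ φ ∨' sub σ ψ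
  sub σ (φ ⇒' ψ)   = sub σ φ ⇒' sub σ ψ
  sub σ (∀' φ)     = ∀' (sub (lift σ) φ)
  sub σ (∃' φ)     = ∃' (sub (lift σ) φ)

  wk : Formula L n → Formula L (suc n)
  wk = sub (var ∘ suc)

  inst : Term L n → Fin (suc n) → Term L n
  inst t zero    = t
  inst t (suc i) = var i

  infix 9 _⟨_⟩

  _⟨_⟩ : Formula L (suc n) → Term L n → Formula L n
  φ ⟨ t ⟩ = sub (inst t) φ

module _ {L : Signature ℓ} {C : Set ℓ} where

  embedᵗ : Term L n → Term (L ∪ᶜ C) n
  embedᵗˢ : Vec (Term L n) k → Vec (Term (L ∪ᶜ C) n) k

  embedᵗ (var i)    = var i
  embedᵗ (fun f ts) = fun (old f) (embedᵗˢ ts)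

  embedᵗˢ []       = []
  embedᵗˢ (t ∷ ts) = embedᵗ t ∷ embedᵗˢ ts

  embed : Formula L n → Formula (L ∪ᶜ C) n
  embed ⊥'         = ⊥'
  embed (s ≈' t)   = embedᵗ s ≈' embedᵗ t
  embed (rel R ts) = rel R (embedᵗˢ ts)
  embed (φ ∧' ψ)   = embed φ ∧' embed ψ
  embed (φ ∨' ψ)   = embed φ ∨' embed ψ
  embed (φ ⇒' ψ)   = embed φ ⇒' embed ψ
  embed (∀' φ)     = ∀' (embed φ)
  embed (∃' φ)     = ∃' (embed φ)

  const : C → Term (L ∪ᶜ C) n
  const c = fun (con c) []

  infix 9 _⟪_⟫

  _⟪_⟫ : Formula L n → Vec C n → Sentence (L ∪ᶜ C)
  φ ⟪ cs ⟫ = sub (const ∘ lookup cs) (embed φ)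

infix 4 _⊢_

data _⊢_ {L : Signature ℓ} {n : ℕ} : List (Formula L n) → Formula L n → Set ℓ where
  hyp    : ∀ {Γ φ} → φ ∈ˡ Γ → Γ ⊢ φ
  weaken : ∀ {Γ Δ φ} → Γ ⊆ˡ Δ → Γ ⊢ φ → Δ ⊢ φ
  raa    : ∀ {Γ φ} → ¬' φ List.∷ Γ ⊢ ⊥' → Γ ⊢ φ
  ⇒I     : ∀ {Γ φ ψ} → φ List.∷ Γ ⊢ ψ → Γ ⊢ φ ⇒' ψ
  ⇒E     : ∀ {Γ φ ψ} → Γ ⊢ φ ⇒' ψ → Γ ⊢ φ → Γ ⊢ ψ
  ∧I     : ∀ {Γ φ ψ} → Γ ⊢ φ → Γ ⊢ ψ → Γ ⊢ φ ∧' ψ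
  ∧E₁    : ∀ {Γ φ ψ} → Γ ⊢ φ ∧' ψ → Γ ⊢ φ
  ∧E₂    : ∀ {Γ φ ψ} → Γ ⊢ φ ∧' ψ → Γ ⊢ ψ
  ∨I₁    : ∀ {Γ φ ψ} → Γ ⊢ φ → Γ ⊢ φ ∨' ψ
  ∨I₂    : ∀ {Γ φ ψ} → Γ ⊢ ψ → Γ ⊢ φ ∨' ψ
  ∨E     : ∀ {Γ φ ψ χ} → Γ ⊢ φ ∨' ψ → φ List.∷ Γ ⊢ χ → ψ List.∷ Γ ⊢ χ → Γ ⊢ χ
  ∀I     : ∀ {Γ φ} → List.map wk Γ ⊢ φ → Γ ⊢ ∀' φ
  ∀E     : ∀ {Γ φ} t → Γ ⊢ ∀' φ → Γ ⊢ φ ⟨ t ⟩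
  ∃I     : ∀ {Γ φ} t → Γ ⊢ φ ⟨ t ⟩ → Γ ⊢ ∃' φ
  ∃E     : ∀ {Γ φ ψ} → Γ ⊢ ∃' φ → φ List.∷ List.map wk Γ ⊢ wk ψ → Γ ⊢ ψ
  ≈-refl  : ∀ {Γ t} → Γ ⊢ t ≈' t
  ≈-sym   : ∀ {Γ s t} → Γ ⊢ s ≈' t → Γ ⊢ t ≈' s
  ≈-trans : ∀ {Γ s t u} → Γ ⊢ s ≈' t → Γ ⊢ t ≈' u → Γ ⊢ s ≈' u
  ≈-fun   : ∀ {Γ} (f : Fun L k) {ss ts} →
            Pointwise (λ s t → Γ ⊢ s ≈' t) ss ts → Γ ⊢ fun f ss ≈' fun f ts
  ≈-rel   : ∀ {Γ} (R : Rel L k) {ss ts} →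
            Pointwise (λ s t → Γ ⊢ s ≈' t) ss ts → Γ ⊢ rel R ss → Γ ⊢ rel R ts
  -- Domains are nonempty; since formulas carry their free variables in
  -- their type, this does not follow from the other rules.
  nonempty : ∀ {Γ} → Γ ⊢ ∃' (var zero ≈' var zero)

Theory : Signature ℓ → Set (Level.suc ℓ)
Theory {ℓ} L = Pred (Sentence L) ℓ

infix 4 _⊩_

_⊩_ : {L : Signature ℓ} → Theory L → Sentence L → Set ℓ
T ⊩ φ = ∃ λ Γ → All (_∈ T) Γ × Γ ⊢ φ

Consistent : {L : Signature ℓ} → Theory L → Set ℓ
Consistent T = ¬ (T ⊩ ⊥')

record Complete {L : Signature ℓ} (T : Theory L) : Set ℓ where
  field
    consistent : Consistent T
    decides    : ∀ φ → φ ∈ T ⊎ ¬' φ ∈ T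

HasWitnesses : {L : Signature ℓ} {C : Set ℓ} → Theory (L ∪ᶜ C) → Set ℓ
HasWitnesses {C = C} T = ∀ φ → ∃' φ ∈ T → ∃ λ (c : C) → φ ⟨ const c ⟩ ∈ T

-- The domain is a setoid, whose equality interprets `≈'`, so that domains
-- may be quotients.

record Structure (L : Signature ℓ) : Set (Level.suc ℓ) where
  infix 4 _≈_
  field
    Carrier       : Set ℓ
    _≈_           : Binary.Rel Carrier ℓ
    isEquivalence : IsEquivalence _≈_
    inhabitant    : Carrier
    ⟦fun⟧         : Fun L k → Vec Carrier k → Carrier
    ⟦fun⟧-cong    : (f : Fun L k) → Congruent (Pointwise _≈_) _≈_ (⟦fun⟧ f)
    ⟦rel⟧         : Rel L k → Vec Carrier k → Set ℓ
    ⟦rel⟧-resp    : (R : Rel L k) {as bs : Vec Carrier k} →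
                    Pointwise _≈_ as bs → ⟦rel⟧ R as → ⟦rel⟧ R bs

open Structure public using (Carrier)

module _ {L : Signature ℓ} (M : Structure L) where

  open Structure M hiding (Carrier)

  ⟦_⟧ : Term L n → Vec (Carrier M) n → Carrier M
  ⟦_⟧ˢ : Vec (Term L n) k → Vec (Carrier M) n → Vec (Carrier M) k

  ⟦ var i    ⟧ as = lookup as i
  ⟦ fun f ts ⟧ as = ⟦fun⟧ f (⟦ ts ⟧ˢ as)

  ⟦ []     ⟧ˢ as = []
  ⟦ t ∷ ts ⟧ˢ as = ⟦ t ⟧ as ∷ ⟦ ts ⟧ˢ as

infix 4 _⊨_[_] _⊨_

_⊨_[_] : {L : Signature ℓ} (M : Structure L) → Formula L n → Vec (Carrier M) n → Set ℓ
M ⊨ ⊥'       [ as ] = ⊥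
M ⊨ s ≈' t   [ as ] = Structure._≈_ M (⟦_⟧ M s as) (⟦_⟧ M t as)
M ⊨ rel R ts [ as ] = Structure.⟦rel⟧ M R (⟦_⟧ˢ M ts as)
M ⊨ φ ∧' ψ   [ as ] = M ⊨ φ [ as ] × M ⊨ ψ [ as ]
M ⊨ φ ∨' ψ   [ as ] = M ⊨ φ [ as ] ⊎ M ⊨ ψ [ as ]
M ⊨ φ ⇒' ψ   [ as ] = M ⊨ φ [ as ] → M ⊨ ψ [ as ]
M ⊨ ∀' φ     [ as ] = ∀ b → M ⊨ φ [ b ∷ as ]
M ⊨ ∃' φ     [ as ] = ∃ λ b → M ⊨ φ [ b ∷ as ]

_⊨_ : {L : Signature ℓ} → Structure L → Theory L → Set ℓ
M ⊨ T = ∀ {φ} → φ ∈ T → M ⊨ φ [ [] ]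

solutions : {L : Signature ℓ} (M : Structure L) →
            Formula L (suc n) → Vec (Carrier M) n → Pred (Carrier M) ℓ
solutions M φ as b = M ⊨ φ [ b ∷ as ]

record IsIsomorphism {L : Signature ℓ} (M N : Structure L)
                     (h : Carrier M → Carrier N) : Set ℓ where
  private
    module M = Structure M
    module N = Structure N
  field
    congruent : Congruent M._≈_ N._≈_ h
    bijective : Bijective M._≈_ N._≈_ h
    fun-homo  : (f : Fun L k) (as : Vec M.Carrier k) →
                h (M.⟦fun⟧ f as) N.≈ N.⟦fun⟧ f (Vec.map h as)
    rel-iff   : (R : Rel L k) (as : Vec M.Carrier k) →
                M.⟦rel⟧ R as ⇔ N.⟦rel⟧ R (Vec.map h as)

module _ {L : Signature ℓ} {C : Set ℓ} where

  reduct : Structure (L ∪ᶜ C) → Structure L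
  reduct M = record
    { Carrier       = M.Carrier
    ; _≈_           = M._≈_
    ; isEquivalence = M.isEquivalence
    ; inhabitant    = M.inhabitant
    ; ⟦fun⟧         = λ f → M.⟦fun⟧ (old f)
    ; ⟦fun⟧-cong    = λ f → M.⟦fun⟧-cong (old f)
    ; ⟦rel⟧         = M.⟦rel⟧
    ; ⟦rel⟧-resp    = M.⟦rel⟧-resp
    }
    where module M = Structure M

  named : (M : Structure (L ∪ᶜ C)) → C → Carrier M
  named M c = Structure.⟦fun⟧ M (con c) []

-- Classically, this says that `P` is not contained in any finite set.

Infinite : {A : Set ℓ} → Pred A ℓ → Set ℓ
Infinite {A = A} P = (xs : List A) → ∃ λ x → x ∈ P × x ∉ xs

InfinitelyNamed : {L : Signature ℓ} {C : Set ℓ} → Structure (L ∪ᶜ C) → Set ℓ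
InfinitelyNamed M = ∀ a → Infinite (λ c → Structure._≈_ M (named M c) a)

-- Both `M` and its reduct to `L` are structures `N` in a signature `L′`
-- extending `L`; `ι` reads `L`-formulas in `L′`, and `[_]` is the naming of
-- elements by constants.

Preserving : {L L′ : Signature ℓ} {C : Set ℓ} → Theory (L ∪ᶜ C) →
             (ι : ∀ {n} → Formula L n → Formula L′ n) →
             (N : Structure L′) → (C → Carrier N) → Set ℓ
Preserving {L = L} {C = C} T ι N [_] =
  ∀ {n} (φ : Formula L (suc n)) (cs : Vec C n) →
  (∃' φ) ⟪ cs ⟫ ∈ T → solutions N (ι φ) (Vec.map [_] cs) ≬ U

⊩-closed : {L : Signature ℓ} {T : Theory L} → Complete T → ∀ {φ} → T ⊩ φ → φ ∈ T
⊩-closed complete {φ} (Γ , Γ⊆T , d) with Complete.decides complete φ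
... | inj₁ φ∈T  = φ∈T
... | inj₂ ¬φ∈T = contradiction
  (_ , ¬φ∈T All.∷ Γ⊆T , ⇒E (hyp (here refl)) (weaken there d))
  (Complete.consistent complete)

module Canonical {L : Signature ℓ} {C : Set ℓ} (T : Theory (L ∪ᶜ C))
                 (complete : Complete T) (witnesses : HasWitnesses T) where

  infix 4 _∼_

  _∼_ : C → C → Set ℓ
  c′ ∼ c = (const c′ ≈' const c) ∈ T

  consts : Vec C k → Vec (Term (L ∪ᶜ C) n) k
  consts = Vec.map const

  private
    closed : ∀ {φ} → T ⊩ φ → φ ∈ T
    closed = ⊩-closed complete

    by₀ : ∀ {φ} → List.[] ⊢ φ → φ ∈ T
    by₀ d = closed (_ , All.[] , d)

    by₁ : ∀ {φ ψ} → φ ∈ T → φ List.∷ List.[] ⊢ ψ → ψ ∈ T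
    by₁ p d = closed (_ , p All.∷ All.[] , d)

    by₂ : ∀ {φ ψ χ} → φ ∈ T → ψ ∈ T → φ List.∷ ψ List.∷ List.[] ⊢ χ → χ ∈ T
    by₂ p q d = closed (_ , p All.∷ q All.∷ All.[] , d)

    sub-consts : (σ : Fin m → Term (L ∪ᶜ C) n) (cs : Vec C k) →
                 subᵗˢ σ (consts cs) ≡ consts cs
    sub-consts σ []       = refl
    sub-consts σ (c ∷ cs) = cong (const c ∷_) (sub-consts σ cs)

    inst-graph : (f : Fun L k) (cs : Vec C k) (t : Term (L ∪ᶜ C) 0) →
                 (fun (old f) (consts cs) ≈' var zero) ⟨ t ⟩ ≡ (fun (old f) (consts cs) ≈' t)
    inst-graph f cs t = cong (λ ts → fun (old f) ts ≈' t) (sub-consts (inst t) cs)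

    value : (f : Fun L k) (cs : Vec C k) →
            ∃ λ c → (fun (old f) (consts cs) ≈' const c) ∈ T
    value f cs with witnesses (fun (old f) (consts cs) ≈' var zero)
                      (by₀ (∃I t (subst (λ φ → List.[] ⊢ φ) (sym (inst-graph f cs t)) ≈-refl)))
      where t = fun (old f) (consts cs)
    ... | c , p = c , subst (_∈ T) (inst-graph f cs (const c)) p

    someElement : C
    someElement = proj₁ (witnesses _ (by₀ nonempty))

    equations : {cs ds : Vec C k} → Pointwise _∼_ cs ds →
                ∃ λ Γ → All (_∈ T) Γ ×
                        Pointwise (λ s t → Γ ⊢ s ≈' t) (consts cs) (consts ds)
    equations []       = List.[] , All.[] , []
    equations (p ∷ ps) with equations ps
    ... | Γ , Γ⊆T , ds = _ , p All.∷ Γ⊆T , hyp (here refl) ∷ Pointwise.map (weaken there) ds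

    ∼-sym : ∀ {c d} → c ∼ d → d ∼ c
    ∼-sym p = by₁ p (≈-sym (hyp (here refl)))

    ∼-trans : ∀ {c d e} → c ∼ d → d ∼ e → c ∼ e
    ∼-trans p q = by₂ p q (≈-trans (hyp (here refl)) (hyp (there (here refl))))

  apply : Fun⁺ L C k → Vec C k → C
  apply (old f) cs = proj₁ (value f cs)
  apply (con c) [] = c

  -- This determines the class of `apply (old f) cs`.
  apply-spec : (f : Fun L k) (cs : Vec C k) (c : C) →
               apply (old f) cs ∼ c ⇔ (fun (old f) (consts cs) ≈' const c) ∈ T
  apply-spec f cs c = mk⇔
    (λ p → by₂ (proj₂ (value f cs)) p
             (≈-trans (hyp (here refl)) (hyp (there (here refl)))))
    (λ p → by₂ (proj₂ (value f cs)) p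
             (≈-trans (≈-sym (hyp (here refl))) (hyp (there (here refl)))))

  private
    apply-cong : (f : Fun⁺ L C k) → Congruent (Pointwise _∼_) _∼_ (apply f)
    apply-cong (con c) {[]} {[]} [] = by₀ ≈-refl
    apply-cong (old f) {cs} {ds} ps with equations ps
    ... | Γ , Γ⊆T , es = Equivalence.from (apply-spec f cs _)
      (by₂ (closed (Γ , Γ⊆T , ≈-fun (old f) es)) (proj₂ (value f ds))
        (≈-trans (hyp (here refl)) (hyp (there (here refl)))))

  holds : Rel L k → Vec C k → Set ℓ
  holds R cs = rel R (consts cs) ∈ T

  private
    holds-resp : (R : Rel L k) {cs ds : Vec C k} →
                 Pointwise _∼_ cs ds → holds R cs → holds R ds
    holds-resp R ps r with equations ps
    ... | Γ , Γ⊆T , es = by₂ r (closed (Γ , Γ⊆T , ⇒I (≈-rel R (Pointwise.map (weaken there) es) (hyp (here refl)))))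
                             (⇒E (hyp (there (here refl))) (hyp (here refl)))

  -- The quotient of `C` by `∼`.
  canonicalModel : Structure (L ∪ᶜ C)
  canonicalModel = record
    { Carrier       = C
    ; _≈_           = _∼_
    ; isEquivalence = record { refl = by₀ ≈-refl ; sym = ∼-sym ; trans = ∼-trans }
    ; inhabitant    = someElement
    ; ⟦fun⟧         = apply
    ; ⟦fun⟧-cong    = apply-cong
    ; ⟦rel⟧         = holds
    ; ⟦rel⟧-resp    = holds-resp
    }

  -- `M` is the quotient above, up to identifying the element named by `c`
  -- with the class of `c`.
  record IsCanonicalModel (M : Structure (L ∪ᶜ C)) : Set ℓ where
    field
      infiniteClasses : ∀ c → Infinite (_∼ c)
      identification  : IsIsomorphism canonicalModel M (named M)

{-# OPTIONS --safe #-}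

-- By completeness and the witness property, truth in the canonical model is
-- membership in T, and satisfaction is transported along the identification
-- with M; hence (3) ⇒ (1). Conversely, quantifying over a dummy variable, the
-- preserving condition carries to M every literal about the constants that
-- holds in the canonical model, so naming is an embedding of the canonical
-- model; it is onto since every element of M is named.

module Submission where

open import Defs
open import Data.Empty.Polymorphic using (⊥-elim)
open import Data.Fin.Base using (Fin; zero; suc)
import Data.List.Base as List
open import Data.List.Relation.Unary.All as All using (All)
open import Data.List.Relation.Unary.All.Properties using (++⁺)
open import Data.List.Relation.Unary.Any using (here; there)
open import Data.List.Relation.Binary.Subset.Propositional.Properties using (xs⊆xs++ys; xs⊆ys++xs)
open import Data.Nat.Base using (ℕ; zero; suc)
open import Data.Product.Base using (_×_; _,_; proj₁; proj₂; ∃)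
open import Data.Sum.Base using (inj₁; inj₂)
open import Data.Unit.Base using (tt)
open import Data.Vec.Base as Vec using (Vec; []; _∷_; lookup; tabulate)
open import Data.Vec.Properties using (tabulate∘lookup)
open import Data.Vec.Relation.Binary.Pointwise.Inductive as Pointwise using (Pointwise; []; _∷_)
open import Function.Base using (id; _∘_)
open import Function.Bundles using (_⇔_; mk⇔; module Equivalence)
open import Level using (Level)
open import Relation.Binary.PropositionalEquality using (_≡_; refl; sym; trans; cong; cong₂; subst)
open import Relation.Binary.Structures using (IsEquivalence)
open import Relation.Nullary.Negation using (contradiction)
open import Relation.Unary using (_∈_)

open Equivalence using (to; from)

private
  variable
    ℓ : Level
    k m n o : ℕ

-- Substitution calculus and derivability.

module _ {L : Signature ℓ} where

  subᵗ-cong : {σ τ : Fin n → Term L m} → (∀ i → σ i ≡ τ i) → ∀ t → subᵗ σ t ≡ subᵗ τ t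
  subᵗˢ-cong : {σ τ : Fin n → Term L m} → (∀ i → σ i ≡ τ i) →
               (ts : Vec (Term L n) k) → subᵗˢ σ ts ≡ subᵗˢ τ ts
  subᵗ-cong e (var i)    = e i
  subᵗ-cong e (fun f ts) = cong (fun f) (subᵗˢ-cong e ts)
  subᵗˢ-cong e []       = refl
  subᵗˢ-cong e (t ∷ ts) = cong₂ _∷_ (subᵗ-cong e t) (subᵗˢ-cong e ts)

  lift-cong : {σ τ : Fin n → Term L m} → (∀ i → σ i ≡ τ i) → ∀ i → lift σ i ≡ lift τ i
  lift-cong e zero    = refl
  lift-cong e (suc i) = cong (subᵗ (var ∘ suc)) (e i)

  -- Pointwise agreement is assumed because substitutions that pass under a binder, such as
  -- `lift var` and `var`, are only known to agree at each variable.
  sub-cong : {σ τ : Fin n → Term L m} → (∀ i → σ i ≡ τ i) → ∀ φ → sub σ φ ≡ sub τ φ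
  sub-cong e ⊥'         = refl
  sub-cong e (s ≈' t)   = cong₂ _≈'_ (subᵗ-cong e s) (subᵗ-cong e t)
  sub-cong e (rel R ts) = cong (rel R) (subᵗˢ-cong e ts)
  sub-cong e (φ ∧' ψ)   = cong₂ _∧'_ (sub-cong e φ) (sub-cong e ψ)
  sub-cong e (φ ∨' ψ)   = cong₂ _∨'_ (sub-cong e φ) (sub-cong e ψ)
  sub-cong e (φ ⇒' ψ)   = cong₂ _⇒'_ (sub-cong e φ) (sub-cong e ψ)
  sub-cong e (∀' φ)     = cong ∀' (sub-cong (lift-cong e) φ)
  sub-cong e (∃' φ)     = cong ∃' (sub-cong (lift-cong e) φ)

  subᵗ-var : (t : Term L n) → subᵗ var t ≡ t
  subᵗˢ-var : (ts : Vec (Term L n) k) → subᵗˢ var ts ≡ ts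
  subᵗ-var (var i)    = refl
  subᵗ-var (fun f ts) = cong (fun f) (subᵗˢ-var ts)
  subᵗˢ-var []       = refl
  subᵗˢ-var (t ∷ ts) = cong₂ _∷_ (subᵗ-var t) (subᵗˢ-var ts)

  lift-var : (i : Fin (suc n)) → lift {L = L} var i ≡ var i
  lift-var zero    = refl
  lift-var (suc i) = refl

  sub-var : (φ : Formula L n) → sub var φ ≡ φ
  sub-var ⊥'         = refl
  sub-var (s ≈' t)   = cong₂ _≈'_ (subᵗ-var s) (subᵗ-var t)
  sub-var (rel R ts) = cong (rel R) (subᵗˢ-var ts)
  sub-var (φ ∧' ψ)   = cong₂ _∧'_ (sub-var φ) (sub-var ψ)
  sub-var (φ ∨' ψ)   = cong₂ _∨'_ (sub-var φ) (sub-var ψ)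
  sub-var (φ ⇒' ψ)   = cong₂ _⇒'_ (sub-var φ) (sub-var ψ)
  sub-var (∀' φ)     = cong ∀' (trans (sub-cong lift-var φ) (sub-var φ))
  sub-var (∃' φ)     = cong ∃' (trans (sub-cong lift-var φ) (sub-var φ))

  subᵗ-subᵗ : (σ : Fin n → Term L m) (τ : Fin m → Term L o) (t : Term L n) →
              subᵗ τ (subᵗ σ t) ≡ subᵗ (subᵗ τ ∘ σ) t
  subᵗˢ-subᵗˢ : (σ : Fin n → Term L m) (τ : Fin m → Term L o) (ts : Vec (Term L n) k) →
                subᵗˢ τ (subᵗˢ σ ts) ≡ subᵗˢ (subᵗ τ ∘ σ) ts
  subᵗ-subᵗ σ τ (var i)    = refl
  subᵗ-subᵗ σ τ (fun f ts) = cong (fun f) (subᵗˢ-subᵗˢ σ τ ts)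
  subᵗˢ-subᵗˢ σ τ []       = refl
  subᵗˢ-subᵗˢ σ τ (t ∷ ts) = cong₂ _∷_ (subᵗ-subᵗ σ τ t) (subᵗˢ-subᵗˢ σ τ ts)

  -- Lets composition of substitutions pass under a binder: on old variables both sides reduce, by
  -- `subᵗ-subᵗ`, to applying `τ` and then shifting.
  lift-lift : (σ : Fin n → Term L m) (τ : Fin m → Term L o) (i : Fin (suc n)) →
              subᵗ (lift τ) (lift σ i) ≡ lift (subᵗ τ ∘ σ) i
  lift-lift σ τ zero    = refl
  lift-lift σ τ (suc i) = trans (subᵗ-subᵗ (var ∘ suc) (lift τ) (σ i))
                                (sym (subᵗ-subᵗ τ (var ∘ suc) (σ i)))

  sub-sub : (σ : Fin n → Term L m) (τ : Fin m → Term L o) (φ : Formula L n) →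
            sub τ (sub σ φ) ≡ sub (subᵗ τ ∘ σ) φ
  sub-sub σ τ ⊥'         = refl
  sub-sub σ τ (s ≈' t)   = cong₂ _≈'_ (subᵗ-subᵗ σ τ s) (subᵗ-subᵗ σ τ t)
  sub-sub σ τ (rel R ts) = cong (rel R) (subᵗˢ-subᵗˢ σ τ ts)
  sub-sub σ τ (φ ∧' ψ)   = cong₂ _∧'_ (sub-sub σ τ φ) (sub-sub σ τ ψ)
  sub-sub σ τ (φ ∨' ψ)   = cong₂ _∨'_ (sub-sub σ τ φ) (sub-sub σ τ ψ)
  sub-sub σ τ (φ ⇒' ψ)   = cong₂ _⇒'_ (sub-sub σ τ φ) (sub-sub σ τ ψ)
  sub-sub σ τ (∀' φ)     = cong ∀' (trans (sub-sub (lift σ) (lift τ) φ) (sub-cong (lift-lift σ τ) φ))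
  sub-sub σ τ (∃' φ)     = cong ∃' (trans (sub-sub (lift σ) (lift τ) φ) (sub-cong (lift-lift σ τ) φ))

  -- The left side is what `∃I` asks for when a weakened quantified formula is witnessed by the
  -- newly bound variable.
  wk-inst-zero : (φ : Formula L (suc n)) → sub (lift (var ∘ suc)) φ ⟨ var zero ⟩ ≡ φ
  wk-inst-zero φ =
    trans (sub-sub (lift (var ∘ suc)) (inst (var zero)) φ) (trans (sub-cong e φ) (sub-var φ))
    where
    e : ∀ i → subᵗ (inst (var zero)) (lift (var ∘ suc) i) ≡ var i
    e zero    = refl
    e (suc i) = refl

  -- Suppose there is no counterexample. If `φ` failed at the fresh variable, that variable would be
  -- one; so `φ` holds there, and generalizing contradicts the hypothesis. With Henkin witnesses
  -- this turns a refuted universal sentence into a constant refuting it.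
  ¬∀⊢∃¬ : (φ : Formula L (suc n)) → ¬' ∀' φ List.∷ List.[] ⊢ ∃' (¬' φ)
  ¬∀⊢∃¬ φ = raa (⇒E (hyp (there (here refl))) (∀I (raa (⇒E (hyp (there (here refl)))
    (∃I (var zero) (wk-inst (hyp (here refl))))))))
    where
    wk-inst : ∀ {Γ} → Γ ⊢ ¬' φ → Γ ⊢ ¬' (sub (lift (var ∘ suc)) φ ⟨ var zero ⟩)
    wk-inst {Γ} = subst (λ ψ → Γ ⊢ ¬' ψ) (sym (wk-inst-zero φ))

  -- The congruence rules want a single context, while each equation arrives with its own finite set
  -- of axioms; the contexts are concatenated.
  ⊩-equations : {T : Theory L} {ss ts : Vec (Term L 0) k} →
                Pointwise (λ s t → T ⊩ s ≈' t) ss ts →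
                ∃ λ Γ → All (_∈ T) Γ × Pointwise (λ s t → Γ ⊢ s ≈' t) ss ts
  ⊩-equations []                   = List.[] , All.[] , []
  ⊩-equations ((Γ , Γ⊆T , d) ∷ es) with ⊩-equations es
  ... | Δ , Δ⊆T , ds = Γ List.++ Δ , ++⁺ Γ⊆T Δ⊆T ,
    weaken (xs⊆xs++ys Γ Δ) d ∷ Pointwise.map (weaken (xs⊆ys++xs Δ Γ)) ds

-- Invariance of satisfaction under isomorphism.

module _ {L : Signature ℓ} {M N : Structure L} {h : Carrier M → Carrier N}
         (iso : IsIsomorphism M N h) where

  private
    module M = Structure M
    module N = Structure N
    open IsIsomorphism iso
    open IsEquivalence N.isEquivalence renaming (refl to ≈ᴺ-refl; sym to ≈ᴺ-sym; trans to ≈ᴺ-trans)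

  private
    variable
      as : Vec M.Carrier n
      bs : Vec N.Carrier n

  iso-⟦⟧ : Pointwise (λ a b → h a N.≈ b) as bs → (t : Term L n) →
           h (⟦ M ⟧ t as) N.≈ ⟦ N ⟧ t bs
  iso-⟦⟧ˢ : Pointwise (λ a b → h a N.≈ b) as bs → (ts : Vec (Term L n) k) →
            Pointwise N._≈_ (Vec.map h (⟦_⟧ˢ M ts as)) (⟦_⟧ˢ N ts bs)
  iso-⟦⟧ ps (var i)    = Pointwise.lookup ps i
  iso-⟦⟧ ps (fun f ts) = ≈ᴺ-trans (fun-homo f _) (N.⟦fun⟧-cong f (iso-⟦⟧ˢ ps ts))
  iso-⟦⟧ˢ ps []       = []
  iso-⟦⟧ˢ ps (t ∷ ts) = iso-⟦⟧ ps t ∷ iso-⟦⟧ˢ ps ts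

  -- Environments are related through the equality of `N` instead of by `Vec.map h`: surjectivity
  -- supplies preimages only up to that equality, and the quantifier cases must add them to the
  -- environment. An equivalence is needed since implication is contravariant.
  iso-⊨ : Pointwise (λ a b → h a N.≈ b) as bs → (φ : Formula L n) →
          M ⊨ φ [ as ] ⇔ N ⊨ φ [ bs ]
  iso-⊨ ps ⊥'         = mk⇔ id id
  iso-⊨ ps (s ≈' t)   = mk⇔
    (λ e → ≈ᴺ-trans (≈ᴺ-sym (iso-⟦⟧ ps s)) (≈ᴺ-trans (congruent e) (iso-⟦⟧ ps t)))
    (λ e → proj₁ bijective (≈ᴺ-trans (iso-⟦⟧ ps s) (≈ᴺ-trans e (≈ᴺ-sym (iso-⟦⟧ ps t)))))
  iso-⊨ ps (rel R ts) = mk⇔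
    (λ r → N.⟦rel⟧-resp R (iso-⟦⟧ˢ ps ts) (to (rel-iff R _) r))
    (λ r → from (rel-iff R _) (N.⟦rel⟧-resp R (Pointwise.sym ≈ᴺ-sym (iso-⟦⟧ˢ ps ts)) r))
  iso-⊨ ps (φ ∧' ψ)   = mk⇔
    (λ (p , q) → to (iso-⊨ ps φ) p , to (iso-⊨ ps ψ) q)
    (λ (p , q) → from (iso-⊨ ps φ) p , from (iso-⊨ ps ψ) q)
  iso-⊨ ps (φ ∨' ψ)   = mk⇔
    (λ { (inj₁ p) → inj₁ (to (iso-⊨ ps φ) p)   ; (inj₂ q) → inj₂ (to (iso-⊨ ps ψ) q) })
    (λ { (inj₁ p) → inj₁ (from (iso-⊨ ps φ) p) ; (inj₂ q) → inj₂ (from (iso-⊨ ps ψ) q) })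
  iso-⊨ ps (φ ⇒' ψ)   = mk⇔
    (λ f p → to (iso-⊨ ps ψ) (f (from (iso-⊨ ps φ) p)))
    (λ f p → from (iso-⊨ ps ψ) (f (to (iso-⊨ ps φ) p)))
  iso-⊨ ps (∀' φ)     = mk⇔
    (λ f b → let a , e = proj₂ bijective b in
             to (iso-⊨ (e (IsEquivalence.refl M.isEquivalence) ∷ ps) φ) (f a))
    (λ f a → from (iso-⊨ (≈ᴺ-refl ∷ ps) φ) (f (h a)))
  iso-⊨ ps (∃' φ)     = mk⇔
    (λ (a , p) → h a , to (iso-⊨ (≈ᴺ-refl ∷ ps) φ) p)
    (λ (b , p) → let a , e = proj₂ bijective b in
                 a , from (iso-⊨ (e (IsEquivalence.refl M.isEquivalence) ∷ ps) φ) p)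

-- Satisfaction in a structure and in its reduct.

module _ {L : Signature ℓ} {C : Set ℓ} (M : Structure (L ∪ᶜ C)) where

  open Structure M hiding (Carrier)

  ⟦embed⟧ : (t : Term L n) (as : Vec (Carrier M) n) → ⟦ M ⟧ (embedᵗ t) as ≡ ⟦ reduct M ⟧ t as
  ⟦embed⟧ˢ : (ts : Vec (Term L n) k) (as : Vec (Carrier M) n) →
             ⟦_⟧ˢ M (embedᵗˢ ts) as ≡ ⟦_⟧ˢ (reduct M) ts as
  ⟦embed⟧ (var i)    as = refl
  ⟦embed⟧ (fun f ts) as = cong (⟦fun⟧ (old f)) (⟦embed⟧ˢ ts as)
  ⟦embed⟧ˢ []       as = refl
  ⟦embed⟧ˢ (t ∷ ts) as = cong₂ _∷_ (⟦embed⟧ t as) (⟦embed⟧ˢ ts as)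

  ⊨-embed : (φ : Formula L n) (as : Vec (Carrier M) n) →
            M ⊨ embed φ [ as ] ⇔ reduct M ⊨ φ [ as ]
  ⊨-embed ⊥'         as = mk⇔ id id
  ⊨-embed (s ≈' t)   as rewrite ⟦embed⟧ s as | ⟦embed⟧ t as = mk⇔ id id
  ⊨-embed (rel R ts) as rewrite ⟦embed⟧ˢ ts as = mk⇔ id id
  ⊨-embed (φ ∧' ψ)   as = mk⇔
    (λ (p , q) → to (⊨-embed φ as) p , to (⊨-embed ψ as) q)
    (λ (p , q) → from (⊨-embed φ as) p , from (⊨-embed ψ as) q)
  ⊨-embed (φ ∨' ψ)   as = mk⇔
    (λ { (inj₁ p) → inj₁ (to (⊨-embed φ as) p)   ; (inj₂ q) → inj₂ (to (⊨-embed ψ as) q) })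
    (λ { (inj₁ p) → inj₁ (from (⊨-embed φ as) p) ; (inj₂ q) → inj₂ (from (⊨-embed ψ as) q) })
  ⊨-embed (φ ⇒' ψ)   as = mk⇔
    (λ f p → to (⊨-embed ψ as) (f (from (⊨-embed φ as) p)))
    (λ f p → from (⊨-embed ψ as) (f (to (⊨-embed φ as) p)))
  ⊨-embed (∀' φ)     as = mk⇔
    (λ f b → to (⊨-embed φ (b ∷ as)) (f b))
    (λ f b → from (⊨-embed φ (b ∷ as)) (f b))
  ⊨-embed (∃' φ)     as = mk⇔
    (λ (b , p) → b , to (⊨-embed φ (b ∷ as)) p)
    (λ (b , p) → b , from (⊨-embed φ (b ∷ as)) p)

  -- Evaluates the arguments of generic atomic formulas, whose variables are tabulated through a
  -- shift `ρ` that skips the leading ones.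
  ⟦vars⟧ : (ρ : Fin k → Fin n) (as : Vec (Carrier M) n) →
           ⟦_⟧ˢ M (embedᵗˢ (tabulate (var ∘ ρ))) as ≡ tabulate (lookup as ∘ ρ)
  ⟦vars⟧ {k = zero} ρ as = refl
  ⟦vars⟧ {k = suc _}  ρ as = cong (lookup as (ρ zero) ∷_) (⟦vars⟧ (ρ ∘ suc) as)

-- The truth lemma for the canonical model.

module _ {L : Signature ℓ} {C : Set ℓ} {T : Theory (L ∪ᶜ C)}
         (complete : Complete T) (witnesses : HasWitnesses T) where

  open Complete complete
  open Canonical T complete witnesses

  private
    module K = Structure canonicalModel

    closed : ∀ {φ} → T ⊩ φ → φ ∈ T
    closed = ⊩-closed complete

    by₁ : ∀ {φ ψ} → φ ∈ T → φ List.∷ List.[] ⊢ ψ → ψ ∈ T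
    by₁ p d = closed (_ , p All.∷ All.[] , d)

    by₂ : ∀ {φ ψ χ} → φ ∈ T → ψ ∈ T → φ List.∷ ψ List.∷ List.[] ⊢ χ → χ ∈ T
    by₂ p q d = closed (_ , p All.∷ q All.∷ All.[] , d)

    ⊥∉T : ∀ {A : Set ℓ} → ⊥' ∈ T → A
    ⊥∉T p = contradiction (_ , p All.∷ All.[] , hyp (here refl)) consistent

    ¬∈T⇒∉T : ∀ {φ} {A : Set ℓ} → ¬' φ ∈ T → φ ∈ T → A
    ¬∈T⇒∉T p q = ⊥∉T (by₂ p q (⇒E (hyp (here refl)) (hyp (there (here refl)))))

    ≈-symᵀ : ∀ {s t} → (s ≈' t) ∈ T → (t ≈' s) ∈ T
    ≈-symᵀ p = by₁ p (≈-sym (hyp (here refl)))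

    ≈-transᵀ : ∀ {s t u} → (s ≈' t) ∈ T → (t ≈' u) ∈ T → (s ≈' u) ∈ T
    ≈-transᵀ p q = by₂ p q (≈-trans (hyp (here refl)) (hyp (there (here refl))))

    equations : {ss ts : Vec (Term (L ∪ᶜ C) 0) k} →
                Pointwise (λ s t → (s ≈' t) ∈ T) ss ts →
                ∃ λ Γ → All (_∈ T) Γ × Pointwise (λ s t → Γ ⊢ s ≈' t) ss ts
    equations ps = ⊩-equations
      (Pointwise.map (λ p → _ , p All.∷ All.[] , hyp (here refl)) ps)

    ≈-funᵀ : (f : Fun⁺ L C k) {ss ts : Vec (Term (L ∪ᶜ C) 0) k} →
             Pointwise (λ s t → (s ≈' t) ∈ T) ss ts → (fun f ss ≈' fun f ts) ∈ T
    ≈-funᵀ f ps with equations ps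
    ... | Γ , Γ⊆T , ds = closed (Γ , Γ⊆T , ≈-fun f ds)

    ≈-relᵀ : (R : Rel L k) {ss ts : Vec (Term (L ∪ᶜ C) 0) k} →
             Pointwise (λ s t → (s ≈' t) ∈ T) ss ts → rel R ss ∈ T → rel R ts ∈ T
    ≈-relᵀ R ps r with equations ps
    ... | Γ , Γ⊆T , ds = closed (_ , r All.∷ Γ⊆T ,
      ≈-rel R (Pointwise.map (weaken there) ds) (hyp (here refl)))

    _[_/] : Formula (L ∪ᶜ C) n → Vec C n → Sentence (L ∪ᶜ C)
    φ [ cs /] = sub (const ∘ lookup cs) φ

    -- Matches the instances produced by `∀E`, `∃I` and the witness property with the extended
    -- environment in the quantifier cases of `truth`.
    inst-const : (φ : Formula (L ∪ᶜ C) (suc n)) (c : C) (cs : Vec C n) →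
                 sub (lift (const ∘ lookup cs)) φ ⟨ const c ⟩ ≡ φ [ c ∷ cs /]
    inst-const φ c cs =
      trans (sub-sub (lift (const ∘ lookup cs)) (inst (const c)) φ) (sub-cong e φ)
      where
      e : ∀ i → subᵗ (inst (const c)) (lift (const ∘ lookup cs) i) ≡ const (lookup (c ∷ cs) i)
      e zero    = refl
      e (suc i) = refl

  canonical-⟦⟧ : (t : Term (L ∪ᶜ C) n) (cs : Vec C n) →
                 (subᵗ (const ∘ lookup cs) t ≈' const (⟦ canonicalModel ⟧ t cs)) ∈ T
  canonical-⟦⟧ˢ : (ts : Vec (Term (L ∪ᶜ C) n) k) (cs : Vec C n) →
                  Pointwise (λ s t → (s ≈' t) ∈ T)
                    (subᵗˢ (const ∘ lookup cs) ts) (consts (⟦_⟧ˢ canonicalModel ts cs))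
  canonical-⟦⟧ (var i)            cs = IsEquivalence.refl K.isEquivalence
  canonical-⟦⟧ (fun (con c) [])   cs = IsEquivalence.refl K.isEquivalence
  canonical-⟦⟧ (fun (old f) ts)   cs = ≈-transᵀ (≈-funᵀ (old f) (canonical-⟦⟧ˢ ts cs))
    -- At reflexivity, `apply-spec` says that `T` contains the equation defining the chosen value of
    -- `f` on constants.
    (to (apply-spec f _ _) (IsEquivalence.refl K.isEquivalence))
  canonical-⟦⟧ˢ []       cs = []
  canonical-⟦⟧ˢ (t ∷ ts) cs = canonical-⟦⟧ t cs ∷ canonical-⟦⟧ˢ ts cs

  -- Henkin's induction. Closure of `T` under deduction is used throughout; completeness settles
  -- disjunction and implication, witnesses settle `∃'`, and `∀'` takes both.
  truth : (φ : Formula (L ∪ᶜ C) n) (cs : Vec C n) →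
          canonicalModel ⊨ φ [ cs ] ⇔ sub (const ∘ lookup cs) φ ∈ T
  truth ⊥'         cs = mk⇔ ⊥-elim ⊥∉T
  truth (s ≈' t)   cs = mk⇔
    (λ e → ≈-transᵀ (canonical-⟦⟧ s cs) (≈-transᵀ e (≈-symᵀ (canonical-⟦⟧ t cs))))
    (λ e → ≈-transᵀ (≈-symᵀ (canonical-⟦⟧ s cs)) (≈-transᵀ e (canonical-⟦⟧ t cs)))
  truth (rel R ts) cs = mk⇔
    (≈-relᵀ R (Pointwise.sym ≈-symᵀ (canonical-⟦⟧ˢ ts cs)))
    (≈-relᵀ R (canonical-⟦⟧ˢ ts cs))
  truth (φ ∧' ψ)   cs = mk⇔
    (λ (p , q) → by₂ (to (truth φ cs) p) (to (truth ψ cs) q)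
                   (∧I (hyp (here refl)) (hyp (there (here refl)))))
    (λ p → from (truth φ cs) (by₁ p (∧E₁ (hyp (here refl)))) ,
           from (truth ψ cs) (by₁ p (∧E₂ (hyp (here refl)))))
  truth (φ ∨' ψ)   cs = mk⇔
    (λ { (inj₁ p) → by₁ (to (truth φ cs) p) (∨I₁ (hyp (here refl)))
       ; (inj₂ q) → by₁ (to (truth ψ cs) q) (∨I₂ (hyp (here refl))) })
    prime
    where
    prime : (φ ∨' ψ) [ cs /] ∈ T → canonicalModel ⊨ φ ∨' ψ [ cs ]
    prime p with decides (φ [ cs /])
    ... | inj₁ q = inj₁ (from (truth φ cs) q)
    -- Disjunctive syllogism: the refuted first disjunct yields the second by explosion, which here
    -- is `raa` with its assumption ignored.
    ... | inj₂ q = inj₂ (from (truth ψ cs) (by₂ p q (∨E (hyp (here refl))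
      (raa (⇒E (hyp (there (there (there (here refl))))) (hyp (there (here refl)))))
      (hyp (here refl)))))
  truth (φ ⇒' ψ)   cs = mk⇔ implication
    (λ p q → from (truth ψ cs) (by₂ p (to (truth φ cs) q)
               (⇒E (hyp (here refl)) (hyp (there (here refl))))))
    where
    implication : canonicalModel ⊨ φ ⇒' ψ [ cs ] → (φ ⇒' ψ) [ cs /] ∈ T
    implication f with decides (φ [ cs /])
    ... | inj₁ p = by₁ (to (truth ψ cs) (f (from (truth φ cs) p))) (⇒I (hyp (there (here refl))))
    ... | inj₂ p = by₁ p (⇒I (raa (⇒E (hyp (there (there (here refl)))) (hyp (there (here refl))))))
  truth (∀' φ)     cs = mk⇔ generalize
    (λ p c → from (truth φ (c ∷ cs))
               (subst (_∈ T) (inst-const φ c cs) (by₁ p (∀E (const c) (hyp (here refl))))))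
    where
    generalize : canonicalModel ⊨ ∀' φ [ cs ] → (∀' φ) [ cs /] ∈ T
    generalize f with decides ((∀' φ) [ cs /])
    ... | inj₁ p = p
    -- A refuted universal sentence would have a counterexample named by some `c`, contrary to
    -- `f c`.
    ... | inj₂ p with witnesses _ (by₁ p (¬∀⊢∃¬ _))
    ...   | c , q = ¬∈T⇒∉T q
      (subst (_∈ T) (sym (inst-const φ c cs)) (to (truth φ (c ∷ cs)) (f c)))
  truth (∃' φ)     cs = mk⇔
    (λ (c , p) → by₁ (subst (_∈ T) (sym (inst-const φ c cs)) (to (truth φ (c ∷ cs)) p))
                   (∃I (const c) (hyp (here refl))))
    (λ p → let c , q = witnesses _ p in
           c , from (truth φ (c ∷ cs)) (subst (_∈ T) (inst-const φ c cs) q))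

  -- The preserving condition against canonicity.

  module _ (M : Structure (L ∪ᶜ C)) where

    private
      module M = Structure M
      module ≈ᴹ = IsEquivalence M.isEquivalence

    canonical⇒preserving : IsCanonicalModel M → Preserving T embed M (named M)
    canonical⇒preserving canonical φ cs p =
      -- `(∃' φ) ⟪ cs ⟫` unfolds to the very instance of `embed (∃' φ)` that `truth` speaks of.
      let b , q = to (iso-⊨ identification (namedˢ cs) (embed (∃' φ))) (from (truth (embed (∃' φ)) cs) p)
      in b , q , tt
      where
      open IsCanonicalModel canonical
      namedˢ : (ds : Vec C n) → Pointwise (λ d b → named M d M.≈ b) ds (Vec.map (named M) ds)
      namedˢ []       = []
      namedˢ (d ∷ ds) = ≈ᴹ.refl ∷ namedˢ ds

    preserving⇒canonical : InfinitelyNamed M → Preserving T embed M (named M) → IsCanonicalModel M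
    preserving⇒canonical infinite preserving = record
      -- The infinitely many names of the element `named M c` all lie in the class of `c`, by
      -- injectivity of naming.
      { infiniteClasses = λ c xs → let d , e , d∉xs = infinite (named M c) xs in
                                   d , named-injective e , d∉xs
      ; identification  = record
        { congruent = named-cong
        -- Avoiding the empty list gives some name of `a`, hence surjectivity.
        ; bijective = named-injective , λ a → let c , e , _ = infinite a List.[] in
                      c , λ d∼c → ≈ᴹ.trans (named-cong d∼c) e
        ; fun-homo  = named-fun
        ; rel-iff   = λ R cs → mk⇔ (named-rel R cs) (named-rel⁻¹ R cs)
        }
      }
      where
      -- The preserving condition restated through `truth`. The element `b` obtained in `M` need not
      -- be `named M c`, so below variable `zero` is always a dummy and the constants of interest
      -- are parameters.
      transfer : (φ : Formula L (suc n)) (c : C) (cs : Vec C n) →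
                 canonicalModel ⊨ embed φ [ c ∷ cs ] →
                 ∃ λ b → M ⊨ embed φ [ b ∷ Vec.map (named M) cs ]
      transfer φ c cs p = let b , q , _ = preserving φ cs (to (truth (embed (∃' φ)) cs) (c , p)) in b , q

      ⟦shifted⟧ : (N : Structure (L ∪ᶜ C)) (b : Carrier N) (as : Vec (Carrier N) k) →
                  ⟦_⟧ˢ N (embedᵗˢ (tabulate (var ∘ suc))) (b ∷ as) ≡ as
      ⟦shifted⟧ N b as = trans (⟦vars⟧ N suc (b ∷ as)) (tabulate∘lookup as)

      -- Two places are skipped in the graph of a function: the dummy variable and the parameter for
      -- the value.
      ⟦shifted²⟧ : (N : Structure (L ∪ᶜ C)) (a b : Carrier N) (as : Vec (Carrier N) k) →
                   ⟦_⟧ˢ N (embedᵗˢ (tabulate (λ i → var (suc (suc i))))) (a ∷ b ∷ as) ≡ as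
      ⟦shifted²⟧ N a b as = trans (⟦vars⟧ N (λ i → suc (suc i)) (a ∷ b ∷ as)) (tabulate∘lookup as)

      named-cong : ∀ {c d} → c ∼ d → named M c M.≈ named M d
      named-cong {c} {d} p =
        proj₂ (transfer (var (suc zero) ≈' var (suc (suc zero))) c (c ∷ d ∷ []) p)

      -- Negated atoms transfer as well: were the equation refuted by `T`, its negation would hold
      -- in the canonical model and so in `M`, against `e`.
      named-injective : ∀ {c d} → named M c M.≈ named M d → c ∼ d
      named-injective {c} {d} e with decides (const c ≈' const d)
      ... | inj₁ p = p
      ... | inj₂ p = ⊥-elim (proj₂
        (transfer (¬' (var (suc zero) ≈' var (suc (suc zero)))) c (c ∷ d ∷ []) (¬∈T⇒∉T p)) e)

      named-fun : (f : Fun⁺ L C k) (cs : Vec C k) →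
                  named M (apply f cs) M.≈ M.⟦fun⟧ f (Vec.map (named M) cs)
      named-fun (con c) [] = ≈ᴹ.refl
      named-fun (old f) cs =
        let c     = apply (old f) cs
            -- The value `c` is passed as the first parameter, since the dummy's witness in `M` is
            -- uncontrolled.
            b , e = transfer (var (suc zero) ≈' fun f (tabulate (λ i → var (suc (suc i))))) c (c ∷ cs)
                      (subst (λ ds → c ∼ apply (old f) ds) (sym (⟦shifted²⟧ canonicalModel c c cs))
                        (IsEquivalence.refl K.isEquivalence))
        in subst (λ as → named M c M.≈ M.⟦fun⟧ (old f) as)
             (⟦shifted²⟧ M b (named M c) (Vec.map (named M) cs)) e

      named-rel : (R : Rel L k) (cs : Vec C k) → holds R cs → M.⟦rel⟧ R (Vec.map (named M) cs)
      named-rel R cs r =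
        -- Any element can fill the dummy place; `cs` may be empty, so the inhabitant is taken.
        let b , s = transfer (rel R (tabulate (var ∘ suc))) K.inhabitant cs
                      (subst (holds R) (sym (⟦shifted⟧ canonicalModel K.inhabitant cs)) r)
        in subst (M.⟦rel⟧ R) (⟦shifted⟧ M b (Vec.map (named M) cs)) s

      named-rel⁻¹ : (R : Rel L k) (cs : Vec C k) → M.⟦rel⟧ R (Vec.map (named M) cs) → holds R cs
      named-rel⁻¹ R cs s with decides (rel R (consts cs))
      ... | inj₁ r = r
      ... | inj₂ r =
        let b , ¬s = transfer (¬' rel R (tabulate (var ∘ suc))) K.inhabitant cs
                       (¬∈T⇒∉T r ∘ subst (holds R) (⟦shifted⟧ canonicalModel K.inhabitant cs))
        in ⊥-elim (¬s (subst (M.⟦rel⟧ R) (sym (⟦shifted⟧ M b (Vec.map (named M) cs))) s))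

-- The condition in `M` and in its reduct, and the equivalences.

module _ {L : Signature ℓ} {C : Set ℓ} (T : Theory (L ∪ᶜ C)) (M : Structure (L ∪ᶜ C)) where

  preserving-reduct : Preserving T embed M (named M) → Preserving T id (reduct M) (named M)
  preserving-reduct preserving φ cs p =
    let b , q , u = preserving φ cs p in b , to (⊨-embed M φ (b ∷ Vec.map (named M) cs)) q , u

  preserving-expansion : Preserving T id (reduct M) (named M) → Preserving T embed M (named M)
  preserving-expansion preserving φ cs p =
    let b , q , u = preserving φ cs p in b , from (⊨-embed M φ (b ∷ Vec.map (named M) cs)) q , u

theorem5p1 : ∀ {ℓ} (L : Signature ℓ) (T₀ : Theory L) → Consistent T₀ →
    (C : Set ℓ) (T : Theory (L ∪ᶜ C)) → (∀ {φ} → φ ∈ T₀ → embed φ ∈ T) →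
    (complete : Complete T) (witnesses : HasWitnesses T) →
    (M₀ : Structure L) → M₀ ⊨ T₀ →
    (M : Structure (L ∪ᶜ C)) → reduct M ≡ M₀ → InfinitelyNamed M →
    (Preserving T embed M (named M) ⇔ Preserving T id (reduct M) (named M)) ×
    (Preserving T id (reduct M) (named M) ⇔ Canonical.IsCanonicalModel T complete witnesses M)
theorem5p1 L T₀ _ C T _ complete witnesses M₀ _ M _ infinite =
  mk⇔ {A = PreservingM} {B = PreservingReduct}
    (λ p → preserving-reduct T M p) (λ p → preserving-expansion T M p) ,
  -- Both directions pass through the condition on `M`, which closes the circle of the three
  -- conditions.
  mk⇔ {A = PreservingReduct}
    (λ p → preserving⇒canonical complete witnesses M infinite (preserving-expansion T M p))
    (λ canonical → preserving-reduct T M (canonical⇒preserving complete witnesses M canonical))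
  where
  PreservingM PreservingReduct : Set _
  PreservingM      = Preserving T embed M (named M)
  PreservingReduct = Preserving T id (reduct M) (named M)
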